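{- Let $\Sigma=(N_C,N_R)$ be a signature and let $\mathcal{C}v$ be a finitely generated complete covariety over $\Sigma$ (i.e. of $\Sigma$-models). Then $GCI(\mathcal{C}v)$ is finitely based: there is a finite set $\mathcal{T}$ of $\Sigma$-GCIs such that $\mathcal{T}\subseteq GCI(\mathcal{C}v)$ and $\mathcal{T}\models\varphi$ for every $\varphi\in GCI(\mathcal{C}v)$.
   Context: A signature $\Sigma=(N_C,N_R)$ consists of a set $N_C$ of concept names and a set $N_R$ of role names. The set $\mathcal{EC}(\Sigma)$ of concept descriptions (description logic $\mathcal{ALC}$) is inductively generated by: $\bot,\top$; every $c\in N_C$; $C\sqcup D$, $C\sqcap D$, $C^c$ for $C,D\in\mathcal{EC}(\Sigma)$; $\forall r.C$, $\exists r.C$ for $C\in\mathcal{EC}(\Sigma)$, $r\in N_R$. A $\Sigma$-model $\mathcal{I}$ consists of a non-empty set $\Delta^{\mathcal{I}}$ (the carrier), a subset $c^{\mathcal{I}}\subseteq\Delta^{\mathcal{I}}$ for each $c\in N_C$ and a binary relation $r^{\mathcal{I}}\subseteq\Delta^{\mathcal{I}}\times\Delta^{\mathcal{I}}$ for each $r\in N_R$; it is finite if its carrier is. The evaluation $C^{\mathcal{I}}\subseteq\Delta^{\mathcal{I}}$ of a concept description is defined by: $\top^{\mathcal{I}}=\Delta^{\mathcal{I}}$, $\bot^{\mathcal{I}}=\emptyset$, concept names are evaluated as given, $\sqcup,\sqcap$ are union and intersection, $(C^c)^{\mathcal{I}}=\Delta^{\mathcal{I}}\setminus C^{\mathcal{I}}$,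 $(\forall r.C)^{\mathcal{I}}=\{x\mid \forall y,\ (x,y)\in r^{\mathcal{I}}\Rightarrow y\in C^{\mathcal{I}}\}$, $(\exists r.C)^{\mathcal{I}}=\{x\mid \exists y,\ (x,y)\in r^{\mathcal{I}}\text{ and } y\in C^{\mathcal{I}}\}$. A $\Sigma$-GCI is a sentence $C\sqsubseteq D$ or $C\equiv D$ with $C,D\in\mathcal{EC}(\Sigma)$; $\mathcal{I}\models C\sqsubseteq D$ iff $C^{\mathcal{I}}\subseteq D^{\mathcal{I}}$, and $\mathcal{I}\models C\equiv D$ iff $C^{\mathcal{I}}=D^{\mathcal{I}}$. $\mathcal{T}\models\varphi$ means that every $\Sigma$-model satisfying all GCIs in $\mathcal{T}$ satisfies $\varphi$. For a class $\mathcal{C}$ of $\Sigma$-models, $GCI(\mathcal{C})=\{C\sqsubseteq D\mid \forall\mathcal{I}\in\mathcal{C},\ \mathcal{I}\models C\sqsubseteq D\}$. A morphism from $\mathcal{I}$ to $\mathcal{I}'$ is a map $\mu:\Delta^{\mathcal{I}}\to\Delta^{\mathcal{I}'}$ such that (1) for all $c\in N_C$, $a\in\Delta^{\mathcal{I}}$: $a\in c^{\mathcal{I}}\Leftrightarrow\mu(a)\in c^{\mathcal{I}'}$; (2) for all $r\in N_R$: (a) $(a,b)\in r^{\mathcal{I}}$ implies $(\mu(a),\mu(b))\in r^{\mathcal{I}'}$; (b) for all $a\in\Delta^{\mathcal{I}}$, $a'\in\Delta^{\mathcal{I}'}$ with $(\mu(a),a')\in r^{\mathcal{I}'}$ there is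 $b\in\Delta^{\mathcal{I}}$ with $(a,b)\in r^{\mathcal{I}}$ and $\mu(b)=a'$. An epimorphism is a surjective morphism. $\mathcal{I}'$ is a homomorphic image of $\mathcal{I}$ if there is an epimorphism from $\mathcal{I}$ to $\mathcal{I}'$. The coproduct $\sum_{i\in\Lambda}\mathcal{I}_i$ of a family of $\Sigma$-models indexed by a set $\Lambda$ has carrier $\{(i,a)\mid i\in\Lambda,a\in\Delta^{\mathcal{I}_i}\}$, interprets $c\in N_C$ as $\{(i,a)\mid a\in c^{\mathcal{I}_i}\}$ and $r\in N_R$ as $\{((i,a),(i,b))\mid (a,b)\in r^{\mathcal{I}_i}\}$. A complete covariety is a class of $\Sigma$-models closed under morphism domains (if $\mathcal{I}'$ is in the class and there is a morphism from $\mathcal{I}$ to $\mathcal{I}'$, then $\mathcal{I}$ is in the class), homomorphic images, and coproducts. For a class $\mathcal{K}$ of $\Sigma$-models, $\mathcal{C}v(\mathcal{K})$ is the complete covariety generated by $\mathcal{K}$ (the smallest one containing $\mathcal{K}$). A complete covariety is finitely generated if it equals $\mathcal{C}v(\mathcal{K})$ for some finite set $\mathcal{K}$ of finite $\Sigma$-models.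
   Formalization: The sets of concept names and role names are assumed finite (the claim fails for infinite signatures whenever the covariety is non-empty), and finite models are taken with decidable interpretations of names, which is automatic classically. -}

module Defs where

open import Axiom.ExcludedMiddle using (ExcludedMiddle)
open import Data.Fin.Base using (Fin)
open import Data.List.Base using (List)
open import Data.List.Membership.Propositional using (_∈_)
open import Data.List.Relation.Unary.All using (All)
open import Data.Product.Base using (Σ; ∃; ∃-syntax; _×_; _,_)
open import Function.Bundles using (_⇔_; _↔_)
open import Function.Definitions using (Surjective)
open import Level using (Level; 0ℓ; suc; _⊔_)
open import Relation.Binary.Core using (Rel)
import Relation.Binary.Definitions as B
open import Relation.Binary.PropositionalEquality.Core using (_≡_)
open import Relation.Unary using (Pred; U; ∅; _∪_; _∩_; ∁; _⊆_; _≐_)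
import Relation.Unary as U

private
  variable
    ℓ k : Level

Finite : Set → Set
Finite A = ∃[ n ] (A ↔ Fin n)

record Signature : Set₁ where
  field
    ConceptName : Set
    RoleName    : Set

open Signature public

infixl 7 _⊓ᶜ_
infixl 6 _⊔ᶜ_
infix  4 _⊑_ _≡ᶜ_

data Concept (S : Signature) : Set where
  ⊥ᶜ ⊤ᶜ     : Concept S
  name      : ConceptName S → Concept S
  _⊔ᶜ_ _⊓ᶜ_ : Concept S → Concept S → Concept S
  compl     : Concept S → Concept S
  all some  : RoleName S → Concept S → Concept S

data Sentence (S : Signature) : Set where
  _⊑_ _≡ᶜ_ : Concept S → Concept S → Sentence S

record Model (S : Signature) : Set₁ where
  field
    Carrier  : Set
    nonempty : Carrier
    conceptI : ConceptName S → Pred Carrier 0ℓ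
    roleI    : RoleName S → Rel Carrier 0ℓ

open Model public

module _ {S : Signature} where

  ⟦_⟧ : Concept S → (I : Model S) → Pred (Carrier I) 0ℓ
  ⟦ ⊥ᶜ       ⟧ I = ∅
  ⟦ ⊤ᶜ       ⟧ I = U
  ⟦ name c   ⟧ I = conceptI I c
  ⟦ C ⊔ᶜ D   ⟧ I = ⟦ C ⟧ I ∪ ⟦ D ⟧ I
  ⟦ C ⊓ᶜ D   ⟧ I = ⟦ C ⟧ I ∩ ⟦ D ⟧ I
  ⟦ compl C  ⟧ I = ∁ (⟦ C ⟧ I)
  ⟦ all r C  ⟧ I = λ x → ∀ y → roleI I r x y → ⟦ C ⟧ I y
  ⟦ some r C ⟧ I = λ x → ∃[ y ] (roleI I r x y × ⟦ C ⟧ I y)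

  infix 3 _⊨_ _⊫_

  _⊨_ : Model S → Sentence S → Set
  I ⊨ C ⊑ D  = ⟦ C ⟧ I ⊆ ⟦ D ⟧ I
  I ⊨ C ≡ᶜ D = ⟦ C ⟧ I ≐ ⟦ D ⟧ I

  _⊫_ : Pred (Sentence S) ℓ → Sentence S → Set (suc 0ℓ ⊔ ℓ)
  T ⊫ φ = ∀ (I : Model S) → (∀ {ψ} → T ψ → I ⊨ ψ) → I ⊨ φ

  data GCI (𝒞 : Pred (Model S) ℓ) : Pred (Sentence S) (suc 0ℓ ⊔ ℓ) where
    gci : ∀ {C D} → (∀ {I} → 𝒞 I → I ⊨ C ⊑ D) → GCI 𝒞 (C ⊑ D)

  -- A finite set T mentions only finitely many names.  So over infinitely many
  -- concept names c, the inclusions c ⊑ ⊥ᶜ valid in the one-point model with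
  -- empty interpretations are not finitely based; likewise for role names and
  -- some r ⊤ᶜ ⊑ ⊥ᶜ.
  FinitelyBased : Pred (Sentence S) ℓ → Set (suc 0ℓ ⊔ ℓ)
  FinitelyBased Γ =
    ∃[ T ] ((_∈ T) ⊆ Γ × (∀ {φ} → Γ φ → (_∈ T) ⊫ φ))

  record IsMorphism (I J : Model S) (μ : Carrier I → Carrier J) : Set where
    field
      concept : ∀ c a → conceptI I c a ⇔ conceptI J c (μ a)
      forth   : ∀ r {a b} → roleI I r a b → roleI J r (μ a) (μ b)
      back    : ∀ r {a a′} → roleI J r (μ a) a′ →
                ∃[ b ] (roleI I r a b × μ b ≡ a′)

  IsEpimorphism : (I J : Model S) → (Carrier I → Carrier J) → Set
  IsEpimorphism I J μ = IsMorphism I J μ × Surjective _≡_ _≡_ μ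

  data CoproductRole {Λ : Set} (I : Λ → Model S) (r : RoleName S) :
       Rel (Σ Λ λ i → Carrier (I i)) 0ℓ where
    inj : ∀ {i a b} → roleI (I i) r a b → CoproductRole I r (i , a) (i , b)

  -- The index set must be inhabited: the empty coproduct has an empty
  -- carrier, so it is not a model.
  coproduct : (Λ : Set) → Λ → (Λ → Model S) → Model S
  coproduct Λ i₀ I = record
    { Carrier  = Σ Λ λ i → Carrier (I i)
    ; nonempty = i₀ , nonempty (I i₀)
    ; conceptI = λ { c (i , a) → conceptI (I i) c a }
    ; roleI    = CoproductRole I
    }

  record IsCompleteCovariety (𝒱 : Pred (Model S) ℓ) : Set (suc 0ℓ ⊔ ℓ) where
    field
      domains    : ∀ {I J} μ → IsMorphism I J μ → 𝒱 J → 𝒱 I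
      images     : ∀ {I J} μ → IsEpimorphism I J μ → 𝒱 I → 𝒱 J
      coproducts : ∀ Λ i₀ I → (∀ i → 𝒱 (I i)) → 𝒱 (coproduct Λ i₀ I)

  data Cv (𝒦 : Pred (Model S) k) : Pred (Model S) (suc 0ℓ ⊔ k) where
    base       : 𝒦 ⊆ Cv 𝒦
    domains    : ∀ {I J} μ → IsMorphism I J μ → Cv 𝒦 J → Cv 𝒦 I
    images     : ∀ {I J} μ → IsEpimorphism I J μ → Cv 𝒦 I → Cv 𝒦 J
    coproducts : ∀ Λ i₀ I → (∀ i → Cv 𝒦 (I i)) → Cv 𝒦 (coproduct Λ i₀ I)

  Cv-isCompleteCovariety : (𝒦 : Pred (Model S) k) → IsCompleteCovariety (Cv 𝒦)
  Cv-isCompleteCovariety 𝒦 = record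
    { domains = domains ; images = images ; coproducts = coproducts }

  Cv-least : {𝒦 : Pred (Model S) k} {𝒱 : Pred (Model S) ℓ} →
             IsCompleteCovariety 𝒱 → 𝒦 ⊆ 𝒱 → Cv 𝒦 ⊆ 𝒱
  Cv-least cc 𝒦⊆𝒱 (base x)              = 𝒦⊆𝒱 x
  Cv-least cc 𝒦⊆𝒱 (domains μ m x)       =
    IsCompleteCovariety.domains cc μ m (Cv-least cc 𝒦⊆𝒱 x)
  Cv-least cc 𝒦⊆𝒱 (images μ e x)        =
    IsCompleteCovariety.images cc μ e (Cv-least cc 𝒦⊆𝒱 x)
  Cv-least cc 𝒦⊆𝒱 (coproducts Λ i₀ I x) =
    IsCompleteCovariety.coproducts cc Λ i₀ I (λ i → Cv-least cc 𝒦⊆𝒱 (x i))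

  -- A subset of, or relation on, a finite set is itself finite only if it is
  -- decidable.  Classically the two decidability fields are automatic; see
  -- finiteCarrier⇒finiteModel.
  record FiniteModel (I : Model S) : Set where
    field
      carrier  : Finite (Carrier I)
      concept? : ∀ c → U.Decidable (conceptI I c)
      role?    : ∀ r → B.Decidable (roleI I r)

  finiteCarrier⇒finiteModel : ExcludedMiddle 0ℓ →
    (I : Model S) → Finite (Carrier I) → FiniteModel I
  finiteCarrier⇒finiteModel em I fin = record
    { carrier = fin ; concept? = λ _ _ → em ; role? = λ _ _ _ → em }

  FinitelyGenerated : Pred (Model S) ℓ → Set (suc 0ℓ ⊔ ℓ)
  FinitelyGenerated 𝒱 =
    Σ (List (Model S)) λ K → All FiniteModel K × 𝒱 ≐ Cv (_∈ K)

{-# OPTIONS --safe #-}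

-- A finitely generated complete covariety has the same valid inclusions as one
-- finite model M, the coproduct of its generators.  Starting from X a = ⊤ᶜ and
-- repeatedly conjoining to X a one step of the back-and-forth conditions at a
-- gives concepts X a whose extensions in M shrink until they stabilise; then
-- "x satisfies X a" is a bisimulation on M.  The finite basis says that the X a
-- cover every model and that each X a implies its own back-and-forth conditions:
-- in any model of it, "x satisfies X a" is a bisimulation with M that relates
-- every point x to some a, so validity of inclusions transfers from M.
module Submission where

open import Defs
open import Data.Empty using (⊥-elim)
open import Data.Fin.Base using (Fin; zero)
import Data.Fin.Properties as Fin
open import Data.List.Base
  using (List; []; _∷_; map; foldr; filter; concatMap; cartesianProduct; allFin; length; lookup)
open import Data.List.Membership.Propositional using (_∈_; find; lose)
open import Data.List.Membership.Propositional.Properties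
  using (∈-map⁺; ∈-map⁻; ∈-allFin; ∈-lookup; ∈-filter⁺; ∈-concatMap⁺; ∈-cartesianProduct⁺)
open import Data.List.Properties using (filter-notAll)
open import Data.List.Relation.Unary.All as All using (All; []; _∷_)
open import Data.List.Relation.Unary.All.Properties using (¬All⇒Any¬)
open import Data.List.Relation.Unary.Any as Any using (Any; here; there)
open import Data.List.Relation.Unary.Any.Properties using (lookup-index)
open import Data.Nat.Base using (_<_)
open import Data.Nat.Induction using (<-wellFounded)
open import Data.Product.Base using (Σ; ∃; ∃-syntax; _×_; _,_; proj₁; proj₂)
open import Data.Product.Function.NonDependent.Propositional using (_×-⇔_)
open import Data.Sum.Base using (inj₁; inj₂)
open import Data.Sum.Function.Propositional using (_⊎-⇔_)
open import Data.Unit.Base using (tt)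
open import Function.Base using (_∘_; id)
open import Function.Bundles using (_⇔_; mk⇔; module Equivalence; module Inverse)
open import Induction.WellFounded using (Acc; acc)
open import Level using (Level; 0ℓ)
import Relation.Binary.Definitions as B
open import Relation.Binary.PropositionalEquality using (_≡_; refl; sym; subst)
open import Relation.Nullary using (¬_; Dec; yes; no; contradiction)
open import Relation.Nullary.Decidable using (map′; ¬?; _×-dec_; _⊎-dec_; _→-dec_)
open import Relation.Unary using (Pred)
import Relation.Unary as U

open Equivalence using (to; from)

private
  variable
    A P : Set
    S   : Signature

-- Finite sets as covering lists, and exhaustive search.

Enumeration : Set → Set
Enumeration A = ∃[ xs ] (∀ (a : A) → a ∈ xs)

finite⇒enumeration : Finite A → Enumeration A
finite⇒enumeration (n , A↔Fin) =
  map from′ (allFin n) ,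
  λ a → subst (_∈ map from′ (allFin n)) (Inverse.strictlyInverseʳ A↔Fin a)
          (∈-map⁺ from′ (∈-allFin (Inverse.to A↔Fin a)))
  where from′ = Inverse.from A↔Fin

Σ-enumeration : ∀ {n} {F : Fin n → Set} →
                (∀ i → Enumeration (F i)) → Enumeration (Σ (Fin n) F)
Σ-enumeration {n} {F} e = concatMap fibre (allFin n) , λ { (i , a) →
  ∈-concatMap⁺ fibre (lose (∈-allFin i) (∈-map⁺ (i ,_) (proj₂ (e i) a))) }
  where
  fibre : Fin n → List (Σ (Fin n) F)
  fibre i = map (i ,_) (proj₁ (e i))

module _ {Q : Pred A 0ℓ} (e : Enumeration A) (Q? : U.Decidable Q) where

  all-dec : Dec (∀ a → Q a)
  all-dec = map′ (λ qs a → All.lookup qs (proj₂ e a)) (λ q → All.tabulate (λ {a} _ → q a))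
                 (All.all? Q? (proj₁ e))

  any-dec : Dec (∃ Q)
  any-dec = map′ (λ q → let a , _ , qa = find q in a , qa) (λ { (a , qa) → lose (proj₂ e a) qa })
                 (Any.any? Q? (proj₁ e))

-- Bisimulations between models.

module _ (I J : Model S) where

  -- Stated at a single pair with `R` left free, so that for an `R` given by concepts the condition
  -- can itself be expressed by a concept.
  record BackAndForth (R : Carrier I → Carrier J → Set) (a : Carrier I) (x : Carrier J) : Set where
    field
      concept : ∀ c → conceptI I c a ⇔ conceptI J c x
      forth   : ∀ r b → roleI I r a b → ∃[ y ] (roleI J r x y × R b y)
      back    : ∀ r y → roleI J r x y → ∃[ b ] (roleI I r a b × R b y)

  IsBisimulation : (Carrier I → Carrier J → Set) → Set
  IsBisimulation R = ∀ {a x} → R a x → BackAndForth R a x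

open BackAndForth

-- Induction on the concept, with equivalences throughout because `compl` reverses implications.
-- `back` serves `all` forwards and `some` backwards; `forth` serves the other two directions.
bisimulation⇒⟦⟧⇔ : {I J : Model S} {R : Carrier I → Carrier J → Set} → IsBisimulation I J R →
                   ∀ C {a x} → R a x → ⟦ C ⟧ I a ⇔ ⟦ C ⟧ J x
bisimulation⇒⟦⟧⇔ {I = I} {J} {R} bisim = go
  where
  go : ∀ C {a x} → R a x → ⟦ C ⟧ I a ⇔ ⟦ C ⟧ J x
  go ⊥ᶜ         _ = mk⇔ id id
  go ⊤ᶜ         _ = mk⇔ id id
  go (name c)   p = concept (bisim p) c
  go (C ⊔ᶜ D)   p = go C p ⊎-⇔ go D p
  go (C ⊓ᶜ D)   p = go C p ×-⇔ go D p
  go (compl C)  p = mk⇔ (_∘ from (go C p)) (_∘ to (go C p))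
  go (all r C)  p = mk⇔
    (λ h y xy → let b , ab , q = back (bisim p) r y xy in to (go C q) (h b ab))
    (λ h b ab → let y , xy , q = forth (bisim p) r b ab in from (go C q) (h y xy))
  go (some r C) p = mk⇔
    (λ { (b , ab , h) → let y , xy , q = forth (bisim p) r b ab in y , xy , to (go C q) h })
    (λ { (y , xy , h) → let b , ab , q = back (bisim p) r y xy in b , ab , from (go C q) h })

-- Morphisms, coproducts and complete covarieties.

morphism⇒bisimulation : {I J : Model S} {μ : Carrier I → Carrier J} → IsMorphism I J μ →
                        IsBisimulation I J (λ a x → μ a ≡ x)
morphism⇒bisimulation m {a} refl = record
  { concept = λ c → concept′ c a
  ; forth   = λ r b ab → _ , forth′ r ab , refl
  ; back    = λ r y → back′ r
  }
  where open IsMorphism m renaming (concept to concept′; forth to forth′; back to back′)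

morphism⇒⟦⟧⇔ : {I J : Model S} {μ : Carrier I → Carrier J} → IsMorphism I J μ →
               ∀ C a → ⟦ C ⟧ I a ⇔ ⟦ C ⟧ J (μ a)
morphism⇒⟦⟧⇔ m C a = bisimulation⇒⟦⟧⇔ (morphism⇒bisimulation m) C refl

coproduct-injection : ∀ {Λ : Set} {i₀} {I : Λ → Model S} i →
                      IsMorphism (I i) (coproduct Λ i₀ I) (i ,_)
coproduct-injection i = record
  { concept = λ c a → mk⇔ id id
  ; forth   = λ r → inj
  ; back    = λ { r (inj ab) → _ , ab , refl }
  }

-- Lets `Cv-least` carry an inclusion from generators to everything they generate. Morphisms
-- preserve and reflect concepts; surjectivity reaches every point of an image, and each point of a
-- coproduct lies in an injected summand.
⊑-isCompleteCovariety : (C D : Concept S) → IsCompleteCovariety (_⊨ C ⊑ D)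
⊑-isCompleteCovariety C D = record
  { domains    = λ μ m J⊨ {a} → from (morphism⇒⟦⟧⇔ m D a) ∘ J⊨ ∘ to (morphism⇒⟦⟧⇔ m C a)
  ; images     = λ { {I} {J} μ (m , onto) I⊨ {x} h →
      let a , μ≡ = onto x
          at = λ E → bisimulation⇒⟦⟧⇔ (morphism⇒bisimulation m) E (μ≡ refl)
      in to (at D) (I⊨ (from (at C) h)) }
  ; coproducts = λ { Λ i₀ I I⊨ {i , a} →
      let at = λ E → morphism⇒⟦⟧⇔ (coproduct-injection {i₀ = i₀} {I} i) E a
      in to (at D) ∘ I⊨ i ∘ from (at C) }
  }

GCI-antitone : ∀ {v w} {𝒱 : Pred (Model S) v} {𝒲 : Pred (Model S) w} →
               𝒱 U.⊆ 𝒲 → GCI 𝒲 U.⊆ GCI 𝒱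
GCI-antitone 𝒱⊆𝒲 (gci valid) = gci (valid ∘ 𝒱⊆𝒲)

GCI⊆GCI-Cv : ∀ {k} {𝒦 : Pred (Model S) k} → GCI 𝒦 U.⊆ GCI (Cv 𝒦)
GCI⊆GCI-Cv (gci {C} {D} valid) = gci (Cv-least (⊑-isCompleteCovariety C D) valid)

finitelyBased-resp-≐ : ∀ {v w} {Γ : Pred (Sentence S) v} {Δ : Pred (Sentence S) w} →
                       Γ U.≐ Δ → FinitelyBased Γ → FinitelyBased Δ
finitelyBased-resp-≐ (Γ⊆Δ , Δ⊆Γ) (T , T⊆Γ , entails) = T , Γ⊆Δ ∘ T⊆Γ , entails ∘ Δ⊆Γ

-- Every inclusion is vacuously valid in an empty class, so the basis must be inconsistent;
-- `⊤ᶜ ⊑ ⊥ᶜ` is, because carriers are nonempty.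
GCI[]-finitelyBased : FinitelyBased (GCI {S = S} (_∈ []))
GCI[]-finitelyBased =
  ((⊤ᶜ ⊑ ⊥ᶜ) ∷ []) ,
  (λ { (here refl) → gci (λ ()) }) ,
  λ { (gci _) I I⊨T _ → ⊥-elim (I⊨T (here refl) {nonempty I} tt) }

-- Concepts built from decided facts and finite families.

literal : Dec P → Concept S → Concept S
literal (yes _) C = C
literal (no _)  C = compl C

literal-spec : (P? : Dec P) (C : Concept S) {I : Model S} {x : Carrier I} →
               ⟦ literal P? C ⟧ I x ⇔ (P ⇔ ⟦ C ⟧ I x)
literal-spec (yes p) C = mk⇔ (λ c → mk⇔ (λ _ → c) (λ _ → p)) (λ p⇔c → to p⇔c p)
literal-spec (no ¬p) C = mk⇔ (λ ¬c → mk⇔ (⊥-elim ∘ ¬p) (⊥-elim ∘ ¬c)) (λ p⇔c → ¬p ∘ from p⇔c)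

infixr 6 _⇒ᶜ_ _∧ᶜ_

-- In use, `P` is a fact about the fixed finite model, settled while the concept is built. The
-- defaults `⊤ᶜ` here and `⊥ᶜ` in `_∧ᶜ_` are the units of the `⨅` and `⨆` that they enter.
_⇒ᶜ_ : Dec P → Concept S → Concept S
yes _ ⇒ᶜ C = C
no _  ⇒ᶜ C = ⊤ᶜ

_∧ᶜ_ : Dec P → Concept S → Concept S
yes _ ∧ᶜ C = C
no _  ∧ᶜ C = ⊥ᶜ

⇒ᶜ-spec : (P? : Dec P) (C : Concept S) {I : Model S} {x : Carrier I} →
          ⟦ P? ⇒ᶜ C ⟧ I x ⇔ (P → ⟦ C ⟧ I x)
⇒ᶜ-spec (yes p) C = mk⇔ (λ c _ → c) (λ f → f p)
⇒ᶜ-spec (no ¬p) C = mk⇔ (λ _ p → contradiction p ¬p) (λ _ → tt)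

∧ᶜ-spec : (P? : Dec P) (C : Concept S) {I : Model S} {x : Carrier I} →
          ⟦ P? ∧ᶜ C ⟧ I x ⇔ (P × ⟦ C ⟧ I x)
∧ᶜ-spec (yes p) C = mk⇔ (p ,_) proj₂
∧ᶜ-spec (no ¬p) C = mk⇔ (λ ()) (¬p ∘ proj₁)

⨅ ⨆ : Enumeration A → (A → Concept S) → Concept S
⨅ (xs , _) f = foldr (λ a C → f a ⊓ᶜ C) ⊤ᶜ xs
⨆ (xs , _) f = foldr (λ a C → f a ⊔ᶜ C) ⊥ᶜ xs

module _ (e : Enumeration A) (f : A → Concept S) {I : Model S} {x : Carrier I} where

  ⨅-spec : ⟦ ⨅ e f ⟧ I x ⇔ (∀ a → ⟦ f a ⟧ I x)
  ⨅-spec = mk⇔ (λ h a → All.lookup (⇒All (proj₁ e) h) (proj₂ e a)) (All⇒ (proj₁ e))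
    where
    ⇒All : ∀ ys → ⟦ foldr (λ a C → f a ⊓ᶜ C) ⊤ᶜ ys ⟧ I x → All (λ a → ⟦ f a ⟧ I x) ys
    ⇒All []       _       = []
    ⇒All (y ∷ ys) (p , h) = p ∷ ⇒All ys h

    All⇒ : ∀ ys → (∀ a → ⟦ f a ⟧ I x) → ⟦ foldr (λ a C → f a ⊓ᶜ C) ⊤ᶜ ys ⟧ I x
    All⇒ []       h = tt
    All⇒ (y ∷ ys) h = h y , All⇒ ys h

  ⨆-spec : ⟦ ⨆ e f ⟧ I x ⇔ (∃[ a ] ⟦ f a ⟧ I x)
  ⨆-spec = mk⇔ (⇒∃ (proj₁ e)) (λ { (a , h) → ∈⇒ h (proj₂ e a) })
    where
    ⇒∃ : ∀ ys → ⟦ foldr (λ a C → f a ⊔ᶜ C) ⊥ᶜ ys ⟧ I x → ∃[ a ] ⟦ f a ⟧ I x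
    ⇒∃ (y ∷ ys) (inj₁ h) = y , h
    ⇒∃ (y ∷ ys) (inj₂ h) = ⇒∃ ys h

    ∈⇒ : ∀ {a ys} → ⟦ f a ⟧ I x → a ∈ ys → ⟦ foldr (λ a C → f a ⊔ᶜ C) ⊥ᶜ ys ⟧ I x
    ∈⇒ h (here refl) = inj₁ h
    ∈⇒ h (there a∈)  = inj₂ (∈⇒ h a∈)

-- Decidable evaluation in finite models.

record EnumeratedModel (M : Model S) : Set where
  field
    points   : Enumeration (Carrier M)
    concept? : ∀ c → U.Decidable (conceptI M c)
    role?    : ∀ r → B.Decidable (roleI M r)

  -- Search over `points` decides the role restrictions, which lets `stabilise` run constructively.
  ⟦_⟧? : ∀ C → U.Decidable (⟦ C ⟧ M)
  ⟦ ⊥ᶜ ⟧?       a = no λ ()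
  ⟦ ⊤ᶜ ⟧?       a = yes tt
  ⟦ name c ⟧?   a = concept? c a
  ⟦ C ⊔ᶜ D ⟧?   a = ⟦ C ⟧? a ⊎-dec ⟦ D ⟧? a
  ⟦ C ⊓ᶜ D ⟧?   a = ⟦ C ⟧? a ×-dec ⟦ D ⟧? a
  ⟦ compl C ⟧?  a = ¬? (⟦ C ⟧? a)
  ⟦ all r C ⟧?  a = all-dec points (λ b → role? r a b →-dec ⟦ C ⟧? b)
  ⟦ some r C ⟧? a = any-dec points (λ b → role? r a b ×-dec ⟦ C ⟧? b)

finite⇒enumeratedModel : {M : Model S} → FiniteModel M → EnumeratedModel M
finite⇒enumeratedModel fin = record
  { points = finite⇒enumeration carrier ; concept? = concept? ; role? = role? }
  where open FiniteModel fin

coproduct-enumeratedModel : ∀ {n} i₀ (I : Fin n → Model S) → (∀ i → EnumeratedModel (I i)) →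
                            EnumeratedModel (coproduct (Fin n) i₀ I)
coproduct-enumeratedModel {n = n} i₀ I e = record
  { points   = Σ-enumeration (points ∘ e)
  ; concept? = λ { c (i , a) → concept? (e i) c a }
  ; role?    = coproduct-role?
  }
  where
  open EnumeratedModel

  coproduct-role? : ∀ r → B.Decidable (roleI (coproduct (Fin n) i₀ I) r)
  -- Roles never cross summands, so the indices in `Fin n` are compared first.
  coproduct-role? r (i , a) (j , b) with i Fin.≟ j
  ... | yes refl = map′ inj (λ { (inj ab) → ab }) (role? (e i) r a b)
  ... | no i≢j   = no λ { (inj _) → i≢j refl }

-- A finite basis for the inclusions valid in one finite model.

module _ (concepts : Enumeration (ConceptName S)) (roles : Enumeration (RoleName S))
         {M : Model S} (enumerated : EnumeratedModel M) where
  open EnumeratedModel enumerated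

  private
    Point = Carrier M

  module _ (X : Point → Concept S) where

    literalsᶜ successorsᶜ : Point → Concept S
    literalsᶜ a = ⨅ concepts λ c → literal (concept? c a) (name c)
    successorsᶜ a = ⨅ roles λ r → ⨅ points λ b → role? r a b ⇒ᶜ some r (X b)

    onlySuccessorsᶜ backAndForthᶜ : Point → Concept S
    onlySuccessorsᶜ a = ⨅ roles λ r → all r (⨆ points λ b → role? r a b ∧ᶜ X b)
    backAndForthᶜ a = literalsᶜ a ⊓ᶜ successorsᶜ a ⊓ᶜ onlySuccessorsᶜ a

    -- `I` is arbitrary, as the enumerations concern only the signature and `M`. Read in `M`, the
    -- equivalence serves the refinement; read in a model of the basis, it yields the bisimulation.
    backAndForthᶜ-spec : ∀ {I a x} →
      ⟦ backAndForthᶜ a ⟧ I x ⇔ BackAndForth M I (λ b → ⟦ X b ⟧ I) a x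
    backAndForthᶜ-spec = mk⇔
      (λ { ((l , s) , o) → record
        { concept = λ c → to (literal-spec (concept? c _) (name c)) (to (⨅-spec concepts _) l c)
        ; forth   = λ r b → to (⇒ᶜ-spec (role? r _ b) (some r (X b)))
                              (to (⨅-spec points _) (to (⨅-spec roles _) s r) b)
        ; back    = λ r y xy →
            let b , h = to (⨆-spec points _) (to (⨅-spec roles _) o r y xy)
            in b , to (∧ᶜ-spec (role? r _ b) (X b)) h
        } })
      (λ h →
        ( from (⨅-spec concepts _) (λ c → from (literal-spec (concept? c _) (name c)) (concept h c))
        , from (⨅-spec roles _) (λ r → from (⨅-spec points _) λ b →
            from (⇒ᶜ-spec (role? r _ b) (some r (X b))) (forth h r b)) )
        , from (⨅-spec roles _) (λ r y xy → from (⨆-spec points _)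
            (let b , q = back h r y xy in b , from (∧ᶜ-spec (role? r _ b) (X b)) q)))

  IsReflexive IsStable : (Point → Concept S) → Set
  IsReflexive X = ∀ a → ⟦ X a ⟧ M a
  IsStable X = ∀ a → M ⊨ X a ⊑ backAndForthᶜ X a

  refine : (Point → Concept S) → Point → Concept S
  refine X a = X a ⊓ᶜ backAndForthᶜ X a

  -- The identity is a bisimulation on `M`, so refinement never removes a diagonal pair. This keeps
  -- the covering axiom of the basis sound.
  refine-reflexive : ∀ {X} → IsReflexive X → IsReflexive (refine X)
  refine-reflexive {X} ref a = ref a , from (backAndForthᶜ-spec X) record
    { concept = λ _ → mk⇔ id id
    ; forth   = λ _ b ab → b , ab , ref b
    ; back    = λ _ b ab → b , ab , ref b
    }

  keeps? : ∀ X → U.Decidable λ ((a , x) : Point × Point) → ⟦ refine X a ⟧ M x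
  keeps? X (a , x) = ⟦ refine X a ⟧? x

  -- The list L bounds the graph {(a , x) ∣ x ∈ ⟦ X a ⟧ M}; a refinement that is
  -- not yet stable loses an element of L.
  stabilise : ∀ X → IsReflexive X →
              (L : List (Point × Point)) → (∀ {a x} → ⟦ X a ⟧ M x → (a , x) ∈ L) →
              Acc _<_ (length L) → ∃[ Y ] (IsReflexive Y × IsStable Y)
  stabilise X ref L bound (acc rec) with All.all? (keeps? X) L
  -- `bound` puts the whole graph of `X` inside `L`, so once all of `L` survives, `X` implies its
  -- own back-and-forth conditions.
  ... | yes kept = X , ref , λ a h → proj₂ (All.lookup kept (bound h))
  ... | no ¬kept = stabilise (refine X) (refine-reflexive ref) (filter (keeps? X) L)
                     (λ h → ∈-filter⁺ (keeps? X) (bound (proj₁ h)) h)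
                     (rec (filter-notAll (keeps? X) L (¬All⇒Any¬ (keeps? X) L ¬kept)))

  GCI-model-finitelyBased : FinitelyBased (GCI (_≡ M))
  GCI-model-finitelyBased = T , sound , entails
    where
    pts = proj₁ points

    stable : ∃[ X ] (IsReflexive X × IsStable X)
    -- `⊤ᶜ` relates all pairs, so the initial bound is the full product.
    stable = stabilise (λ _ → ⊤ᶜ) (λ _ → tt) (cartesianProduct pts pts)
      (λ _ → ∈-cartesianProduct⁺ (proj₂ points _) (proj₂ points _)) (<-wellFounded _)

    X = proj₁ stable

    characterises : Point → Sentence S
    characterises a = X a ⊑ backAndForthᶜ X a

    T : List (Sentence S)
    T = (⊤ᶜ ⊑ ⨆ points X) ∷ map characterises pts

    sound : (_∈ T) U.⊆ GCI (_≡ M)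
    sound (here refl) = gci λ { refl {a} _ → from (⨆-spec points X) (a , proj₁ (proj₂ stable) a) }
    sound (there ψ∈) with ∈-map⁻ characterises ψ∈
    ... | a , _ , refl = gci λ { refl → proj₂ (proj₂ stable) a }

    entails : ∀ {φ} → GCI (_≡ M) φ → (_∈ T) ⊫ φ
    entails (gci {C} {D} valid) I I⊨T {x} h =
      let a , xa = to (⨆-spec points X) (I⊨T (here refl) {x} tt)
      in to (transfer D xa) (valid refl (from (transfer C xa) h))
      where
      transfer : ∀ E {a x} → ⟦ X a ⟧ I x → ⟦ E ⟧ M a ⇔ ⟦ E ⟧ I x
      -- The `characterises` axioms, read in `I` through `backAndForthᶜ-spec`, are the bisimulation
      -- condition.
      transfer = bisimulation⇒⟦⟧⇔ λ {a} h →
        to (backAndForthᶜ-spec X) (I⊨T (there (∈-map⁺ characterises (proj₂ points a))) h)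

-- From the generators to a single model.

GCI-Cv-finitelyBased : Finite (ConceptName S) → Finite (RoleName S) →
                       (K : List (Model S)) → All FiniteModel K → FinitelyBased (GCI (Cv (_∈ K)))
-- The empty family has no coproduct, so it is treated apart.
GCI-Cv-finitelyBased _ _ [] _ =
  finitelyBased-resp-≐ (GCI⊆GCI-Cv , GCI-antitone base) GCI[]-finitelyBased
GCI-Cv-finitelyBased {S} finC finR K@(_ ∷ _) finK =
  -- An inclusion valid in `M` spreads to `Cv (_≡ M)`, which contains `Cv (_∈ K)`; conversely, `M`
  -- lies in `Cv (_∈ K)`.
  finitelyBased-resp-≐ (GCI-antitone Cv-K⊆Cv-M ∘ GCI⊆GCI-Cv , GCI-antitone λ { refl → M∈Cv-K })
    (GCI-model-finitelyBased (finite⇒enumeration finC) (finite⇒enumeration finR)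
      (coproduct-enumeratedModel zero (lookup K) λ i →
        finite⇒enumeratedModel (All.lookup finK (∈-lookup i))))
  where
  M : Model S
  M = coproduct (Fin (length K)) zero (lookup K)

  M∈Cv-K : Cv (_∈ K) M
  M∈Cv-K = coproducts _ _ _ λ i → base (∈-lookup i)

  Cv-K⊆Cv-M : Cv (_∈ K) U.⊆ Cv (_≡ M)
  Cv-K⊆Cv-M = Cv-least (Cv-isCompleteCovariety (_≡ M)) λ I∈K →
    -- A generator is the summand at its position in `K` and injects into `M`, so closure under
    -- domains applies.
    subst (Cv (_≡ M)) (sym (lookup-index I∈K))
      (domains _ (coproduct-injection (Any.index I∈K)) (base refl))

theorem8 : ∀ {ℓ : Level} (S : Signature) → Finite (ConceptName S) → Finite (RoleName S) →
    (𝒱 : Pred (Model S) ℓ) → IsCompleteCovariety 𝒱 → FinitelyGenerated 𝒱 →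
    FinitelyBased (GCI 𝒱)
theorem8 S finC finR 𝒱 _ (K , finK , 𝒱⊆Cv , Cv⊆𝒱) =
  finitelyBased-resp-≐ (GCI-antitone 𝒱⊆Cv , GCI-antitone Cv⊆𝒱)
    (GCI-Cv-finitelyBased finC finR K finK)
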